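{- Let $F:\mathbb{N}\to[\mathbb{N}]$ be a bijection with inverse $G$, such that $$n\ge U\ \wedge\ F(n)=[n_0,\dots,n_i,\dots,n_k]\ \Rightarrow\ n_i<n .$$ Then $\mathrm{unrank}$ (with transformer $F$) is a bijection from $\mathbb{N}$ to $T$, with inverse $\mathrm{rank}$ (with transformer $G$), and the recursive computations of both functions terminate in a finite number of steps.
   Context: $\mathbb{N}=\{0,1,2,\dots\}$ and $[\mathbb{N}]$ denotes the set of finite lists (including the empty list $[\,]$) of natural numbers. $U\in\mathbb{N}$ is a fixed global constant (called ulimit, with default value $0$). Let $A=\{0,1,\dots,U-1\}$ (empty if $U=0$); its elements are called atoms. $T$ is the set of finite multiway trees with atoms in $A$: it is the inductively defined set whose elements are either an atom $a\in A$ or a finite (possibly empty) list $[t_0,\dots,t_k]$ of elements of $T$; atoms and lists are distinct kinds of objects. The function $\mathrm{unrank}$, with transformer $F$, is computed recursively on $n\in\mathbb{N}$ by: $\mathrm{unrank}(n)=n$ (the atom $n$) if $n<U$; and if $n\ge U$ and $F(n-U)=[m_0,\dots,m_k]$, then $\mathrm{unrank}(n)=[\mathrm{unrank}(m_0),\dots,\mathrm{unrank}(m_k)]$ (the empty list if $F(n-U)=[\,]$). The function $\mathrm{rank}$, with transformer $G:[\mathbb{N}]\to\mathbb{N}$, is computed recursively on $t\in T$ by: $\mathrm{rank}(a)=a$ for an atom $a\in A$; and $\mathrm{rank}([t_0,\dots,t_k])=U+G([\mathrm{rank}(t_0),\dots,\mathrm{rank}(t_k)])$ for a (possibly empty) 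list.
   Formalization: The hypothesis is corrected to: n ≥ U and F(n−U) = [n_0,…,n_k] imply n_i < n (F(n−U) in place of F(n)); as written the claim fails for U > 0, e.g. U = 1 with F(0) = [1], where unrank(1) = [unrank(1)] loops. For U = 0 the two agree. -}

module Defs where

open import Data.Fin.Base using (Fin; toℕ; fromℕ<)
open import Data.List.Base using (List; []; _∷_)
open import Data.List.Membership.Propositional using (_∈_)
open import Data.List.Relation.Unary.All using (All; []; _∷_)
open import Data.Nat.Base using (ℕ; _+_; _∸_; _≤_; _<_)
open import Data.Product.Base using (_×_)
open import Function.Definitions using (Bijective; Inverseᵇ)
open import Relation.Binary.PropositionalEquality.Core using (_≡_)

data Tree (U : ℕ) : Set where
  atom : Fin U → Tree U
  list : List (Tree U) → Tree U

IsBijectionWithInverse : {A B : Set} → (A → B) → (B → A) → Set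
IsBijectionWithInverse f g = Bijective _≡_ _≡_ f × Inverseᵇ _≡_ _≡_ f g

-- The index is n ∸ U, the argument to which unrank applies F.  Requiring only
-- that the elements of F n be below n for n ≥ U would leave F 0, …, F (U - 1)
-- unconstrained, and unrank could loop: for U = 1 and F 0 = [ 1 ],
-- unrank 1 = [ unrank 1 ].  The two conditions coincide for U = 0.
Decreasing : ℕ → (ℕ → List ℕ) → Set
Decreasing U F = ∀ {n m} → U ≤ n → m ∈ F (n ∸ U) → m < n

-- Both functions are general recursive programs, presented by their domain
-- predicates: an element of UnrankHalts n (of RankHalts t) is the finite tree
-- of all recursive calls made when the program is run on n (on t), so the
-- predicate holds exactly when that run terminates.

module _ (U : ℕ) (F : ℕ → List ℕ) where

  data UnrankHalts (n : ℕ) : Set where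
    leaf : n < U → UnrankHalts n
    node : U ≤ n → All UnrankHalts (F (n ∸ U)) → UnrankHalts n

  mutual
    unrank : ∀ n → UnrankHalts n → Tree U
    unrank n (leaf n<U)  = atom (fromℕ< n<U)
    unrank n (node _ hs) = list (unrankAll (F (n ∸ U)) hs)

    unrankAll : ∀ ms → All UnrankHalts ms → List (Tree U)
    unrankAll []       []       = []
    unrankAll (m ∷ ms) (h ∷ hs) = unrank m h ∷ unrankAll ms hs

module _ (U : ℕ) (G : List ℕ → ℕ) where

  data RankHalts : Tree U → Set where
    leaf : ∀ a → RankHalts (atom a)
    node : ∀ {ts} → All RankHalts ts → RankHalts (list ts)

  mutual
    rank : ∀ t → RankHalts t → ℕ
    rank (atom a)  (leaf .a) = toℕ a
    rank (list ts) (node hs) = U + G (rankAll ts hs)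

    rankAll : ∀ ts → All RankHalts ts → List ℕ
    rankAll []       []       = []
    rankAll (t ∷ ts) (h ∷ hs) = rank t h ∷ rankAll ts hs

{-# OPTIONS --safe #-}
module Submission where

open import Defs
open import Data.Fin.Properties using (toℕ-fromℕ<; fromℕ<-toℕ; toℕ<n)
open import Data.List.Base using (List; []; _∷_)
open import Data.List.Relation.Unary.All using (All; []; _∷_; tabulate)
open import Data.Nat.Base using (ℕ; _+_; _∸_; _<_)
open import Data.Nat.Induction using (Acc; acc; <-wellFounded)
open import Data.Nat.Properties using (_<?_; ≮⇒≥; ≤⇒≯; m≤m+n; m+[n∸m]≡n; m+n∸m≡n)
open import Data.Product.Base using (Σ-syntax; _,_)
open import Function.Consequences.Propositional
  using (inverseᵇ⇒bijective; strictlyInverseˡ⇒inverseˡ; strictlyInverseʳ⇒inverseʳ)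
open import Function.Definitions using (Inverseᵇ; StrictlyInverseˡ; StrictlyInverseʳ)
open import Relation.Binary.PropositionalEquality
  using (_≡_; refl; trans; cong; cong₂; module ≡-Reasoning)
open import Relation.Nullary using (yes; no; contradiction)

-- For `n` at least `U`, `unrank` calls itself only on elements of `F (n ∸ U)`, all below `n`, so it
-- halts because `<` is well founded; `rank` descends into subtrees. Ranks of atoms are the numbers
-- below `U`, ranks of lists are at least `U`, so the two kinds never collide. On lists the shifts
-- by `U` cancel, `F` and `G` cancel, and induction handles the entries: this gives `rank-unrank`
-- and `unrank-rank`, and a two-sided inverse yields bijectivity.

isBijectionWithInverse : ∀ {A B : Set} {f : A → B} {g : B → A} →
  StrictlyInverseˡ _≡_ f g → StrictlyInverseʳ _≡_ f g → IsBijectionWithInverse f g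
isBijectionWithInverse {f = f} {g} invˡ invʳ = inverseᵇ⇒bijective inverse , inverse
  where
  inverse : Inverseᵇ _≡_ _≡_ f g
  inverse = strictlyInverseˡ⇒inverseˡ f invˡ , strictlyInverseʳ⇒inverseʳ f invʳ

module _ {U : ℕ} {F : ℕ → List ℕ} (decreasing : Decreasing U F) where

  acc⇒unrankHalts : ∀ {n} → Acc _<_ n → UnrankHalts U F n
  acc⇒unrankHalts {n} (acc rec) with n <? U
  ... | yes n<U = leaf n<U
  -- `tabulate` supplies the membership proof that `decreasing` turns into `m < n`.
  ... | no n≮U  = node U≤n (tabulate λ m∈ → acc⇒unrankHalts (rec (decreasing U≤n m∈)))
    where U≤n = ≮⇒≥ n≮U

  unrankHalts : ∀ n → UnrankHalts U F n
  unrankHalts n = acc⇒unrankHalts (<-wellFounded n)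

module _ {U : ℕ} {G : List ℕ → ℕ} where

  mutual
    -- The list traversal is spelled out so that the termination checker sees the descent into
    -- subtrees.
    rankHalts : ∀ t → RankHalts U G t
    rankHalts (atom a)  = leaf a
    rankHalts (list ts) = node (rankHaltsAll ts)

    rankHaltsAll : ∀ ts → All (RankHalts U G) ts
    rankHaltsAll []       = []
    rankHaltsAll (t ∷ ts) = rankHalts t ∷ rankHaltsAll ts

module _ {U : ℕ} {F : ℕ → List ℕ} {G : List ℕ → ℕ} where

  module _ (G∘F : StrictlyInverseʳ _≡_ F G) where

    mutual
      -- Induction on the call tree `h`. Both halting proofs are arbitrary, so the hypothesis
      -- applies directly to the subproofs stored in `hs` and `rs`, with no need for halting proofs
      -- to be unique.
      rank-unrank : ∀ n (h : UnrankHalts U F n) (r : RankHalts U G (unrank U F n h)) →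
        rank U G (unrank U F n h) r ≡ n
      rank-unrank n (leaf n<U)    (leaf _)  = toℕ-fromℕ< n<U
      rank-unrank n (node U≤n hs) (node rs) = begin
        U + G (rankAll U G (unrankAll U F (F (n ∸ U)) hs) rs)
          ≡⟨ cong (λ ms → U + G ms) (rankAll-unrankAll (F (n ∸ U)) hs rs) ⟩
        U + G (F (n ∸ U))
          ≡⟨ cong (U +_) (G∘F (n ∸ U)) ⟩
        U + (n ∸ U)
          ≡⟨ m+[n∸m]≡n U≤n ⟩
        n ∎
        where open ≡-Reasoning

      rankAll-unrankAll : ∀ ms (hs : All (UnrankHalts U F) ms)
        (rs : All (RankHalts U G) (unrankAll U F ms hs)) →
        rankAll U G (unrankAll U F ms hs) rs ≡ ms
      rankAll-unrankAll []       []       []       = refl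
      rankAll-unrankAll (m ∷ ms) (h ∷ hs) (r ∷ rs) =
        cong₂ _∷_ (rank-unrank m h r) (rankAll-unrankAll ms hs rs)

  module _ (F∘G : StrictlyInverseˡ _≡_ F G) where

    mutual
      unrank-rank : ∀ t (r : RankHalts U G t) (h : UnrankHalts U F (rank U G t r)) →
        unrank U F (rank U G t r) h ≡ t
      unrank-rank (atom a)  (leaf .a) (leaf a<U)   = cong atom (fromℕ<-toℕ a a<U)
      -- This case and the next are the mismatches: an atom's rank would be at least `U`, or a
      -- list's rank below `U`.
      unrank-rank (atom a)  (leaf .a) (node U≤a _) = contradiction (toℕ<n a) (≤⇒≯ U≤a)
      unrank-rank (list ts) (node rs) (leaf n<U)   = contradiction n<U (≤⇒≯ (m≤m+n U _))
      unrank-rank (list ts) (node rs) (node _ hs)  =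
        cong list (unrankAll-rankAll ts rs hs
          (trans (cong F (m+n∸m≡n U _)) (F∘G (rankAll U G ts rs))))

      -- The list ms is only propositionally equal to the list of ranks, because
      -- the halting proofs hs come indexed by F (U + G (rankAll U G ts rs) ∸ U).
      unrankAll-rankAll : ∀ ts (rs : All (RankHalts U G) ts)
        {ms} (hs : All (UnrankHalts U F) ms) → ms ≡ rankAll U G ts rs →
        unrankAll U F ms hs ≡ ts
      unrankAll-rankAll []       []       []       refl = refl
      unrankAll-rankAll (t ∷ ts) (r ∷ rs) (h ∷ hs) refl =
        cong₂ _∷_ (unrank-rank t r h) (unrankAll-rankAll ts rs hs refl)

proposition1 : (U : ℕ) (F : ℕ → List ℕ) (G : List ℕ → ℕ) →
    IsBijectionWithInverse F G →
    Decreasing U F →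
    Σ[ unrank-halts ∈ (∀ n → UnrankHalts U F n) ]
    Σ[ rank-halts ∈ (∀ t → RankHalts U G t) ]
    IsBijectionWithInverse
    (λ n → unrank U F n (unrank-halts n))
    (λ t → rank U G t (rank-halts t))
proposition1 U F G (_ , invˡ , invʳ) decreasing =
  halts , rankHalts ,
  isBijectionWithInverse
    (λ t → unrank-rank F∘G t (rankHalts t) (halts (rank U G t (rankHalts t))))
    (λ n → rank-unrank G∘F n (halts n) (rankHalts (unrank U F n (halts n))))
  where
  halts : ∀ n → UnrankHalts U F n
  halts = unrankHalts decreasing

  F∘G : StrictlyInverseˡ _≡_ F G
  F∘G _ = invˡ refl

  G∘F : StrictlyInverseʳ _≡_ F G
  G∘F _ = invʳ refl
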